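{- The ideal $\mathcal L$ on $\omega$ generated by lacunary sets is not $\le_K$-homogeneous (in particular, it is not homogeneous).
   Context: An ideal on a set $X$ is a family of subsets of $X$ closed under finite unions and subsets, containing all finite subsets of $X$ and not containing $X$; $\mathcal I^+=\mathcal P(X)\setminus\mathcal I$. A set $A\subseteq\omega$ is lacunary if $\lim_{n}(a_{n+1}-a_n)=\infty$, where $(a_n)$ is the increasing enumeration of $A$; $\mathcal L$ consists of all subsets of finite unions of lacunary sets (and finite sets). For ideals $\mathcal I$ on $X$ and $\mathcal K$ on $Y$, $\mathcal I\le_K\mathcal K$ (Katětov order) means that there is $f:Y\to X$ with $f^{ -1}[B]\in\mathcal K$ for all $B\in\mathcal I$; $\mathcal I$ and $\mathcal K$ are isomorphic if there is a bijection $f:Y\to X$ with $f^{ -1}[B]\in\mathcal K\iff B\in\mathcal I$. For $A\in\mathcal I^+$, $\mathcal I\restriction A=\{B\cap A:B\in\mathcal I\}$ (an ideal on $A$). $\mathcal I$ is homogeneous if $\mathcal I\restriction A$ is isomorphic to $\mathcal I$ for each $A\in\mathcal I^+$, and $\le_K$-homogeneous if $\mathcal I\restriction A\le_K\mathcal I$ and $\mathcal I\le_K\mathcal I\restriction A$ for each $A\in\mathcal I^+$. -}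

module Defs where

open import Data.Fin.Base using (Fin; toℕ)
open import Data.Fin.Properties using (pigeonhole; toℕ≤pred[n])
open import Data.List.Base using (List; []; _∷_; _++_; [_]; length; lookup; map)
open import Data.List.Extrema.Nat using (max; xs≤max)
open import Data.List.Relation.Unary.All as All using (All; []; _∷_)
open import Data.List.Relation.Unary.All.Properties as All using ()
open import Data.List.Relation.Unary.Any as Any using (Any)
open import Data.List.Relation.Unary.Any.Properties as Any using ()
import Data.List.Membership.Setoid as Membership
open import Data.Nat.Base hiding (pred)
open import Data.Nat.Properties
open import Data.Product using (Σ; ∃; _×_; _,_; proj₁; proj₂)
open import Data.Sum using (_⊎_; inj₁; inj₂; [_,_]′)
open import Data.Unit.Base using (⊤; tt)
open import Function.Base using (_∘_)
open import Function.Bundles using (Func; Injection; Bijection; Equivalence; _⇔_; mk⇔)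
open import Level using (0ℓ)
open import Relation.Binary.Bundles using (Setoid)
open import Relation.Binary.Definitions using (_Respects_)
import Relation.Binary.Construct.On as On
open import Relation.Binary.PropositionalEquality using (_≡_; refl; subst; setoid)
open import Relation.Nullary using (¬_; contradiction)
open import Relation.Unary using (Pred)

-- Sets are setoids, so that a subset A ⊆ X can itself
-- be regarded as a set: its elements are pairs (x , proof of A x), compared
-- by their first components only.

record Subset (X : Setoid 0ℓ 0ℓ) : Set₁ where
  open Setoid X
  field
    pred : Pred Carrier 0ℓ
    resp : pred Respects _≈_

open Subset public

module _ {X : Setoid 0ℓ 0ℓ} where
  open Setoid X using (Carrier)
  open Membership X using () renaming (_∈_ to _∈ₗ_)

  infix 4 _∈_ _⊆_
  infixr 6 _∪_

  _∈_ : Carrier → Subset X → Set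
  x ∈ A = pred A x

  _⊆_ : Subset X → Subset X → Set
  A ⊆ B = ∀ x → x ∈ A → x ∈ B

  _∪_ : Subset X → Subset X → Subset X
  A ∪ B = record
    { pred = λ x → x ∈ A ⊎ x ∈ B
    ; resp = λ { e (inj₁ p) → inj₁ (resp A e p) ; e (inj₂ q) → inj₂ (resp B e q) }
    }

  ⋃ : List (Subset X) → Subset X
  ⋃ As = record
    { pred = λ x → ∃ λ (i : Fin (length As)) → x ∈ lookup As i
    ; resp = λ { e (i , p) → i , resp (lookup As i) e p }
    }

  Full : Subset X
  Full = record { pred = λ _ → ⊤ ; resp = λ _ _ → tt }

  Finite : Subset X → Set
  Finite A = ∃ λ xs → ∀ x → x ∈ A ⇔ x ∈ₗ xs

∣_∣ₛ : {X : Setoid 0ℓ 0ℓ} → Subset X → Setoid 0ℓ 0ℓ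
∣_∣ₛ {X} A = On.setoid X (proj₁ {B = pred A})

preimage : {X Y : Setoid 0ℓ 0ℓ} → Func Y X → Subset X → Subset Y
preimage f B = record
  { pred = λ y → Func.to f y ∈ B
  ; resp = λ e → resp B (Func.cong f e)
  }

-- B ∩ A as a subset of A.
trace : {X : Setoid 0ℓ 0ℓ} (A : Subset X) → Subset X → Subset ∣ A ∣ₛ
trace A B = record { pred = λ x → proj₁ x ∈ B ; resp = resp B }

record Ideal (X : Setoid 0ℓ 0ℓ) : Set₂ where
  field
    Member     : Subset X → Set₁
    ∪-closed   : ∀ A B → Member A → Member B → Member (A ∪ B)
    ⊆-closed   : ∀ A B → A ⊆ B → Member B → Member A
    has-finite : ∀ A → Finite A → Member A
    proper     : ¬ Member Full

infix 4 _∈ᴵ_ _∈⁺_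

_∈ᴵ_ : {X : Setoid 0ℓ 0ℓ} → Subset X → Ideal X → Set₁
A ∈ᴵ I = Ideal.Member I A

_∈⁺_ : {X : Setoid 0ℓ 0ℓ} → Subset X → Ideal X → Set₁
A ∈⁺ I = ¬ (A ∈ᴵ I)

restrict : {X : Setoid 0ℓ 0ℓ} (I : Ideal X) (A : Subset X) → A ∈⁺ I → Ideal ∣ A ∣ₛ
restrict {X} I A A⁺ = record
  { Member     = λ C → ∃ λ B → B ∈ᴵ I × (∀ x → x ∈ C ⇔ x ∈ trace A B)
  ; ∪-closed   = λ { C D (B , B∈I , C≐) (B′ , B′∈I , D≐) →
      B ∪ B′ , I.∪-closed B B′ B∈I B′∈I , λ x → mk⇔
        (λ { (inj₁ c) → inj₁ (to (C≐ x) c) ; (inj₂ d) → inj₂ (to (D≐ x) d) })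
        (λ { (inj₁ b) → inj₁ (from (C≐ x) b) ; (inj₂ b) → inj₂ (from (D≐ x) b) }) }
  ; ⊆-closed   = λ { C D C⊆D (B , B∈I , D≐) →
      image C
      , I.⊆-closed (image C) B (λ { x (a , c) → to (D≐ (x , a)) (C⊆D (x , a) c) }) B∈I
      , λ { (x , a) → mk⇔ (a ,_) (λ { (a′ , c) → resp C X.refl c }) } }
  ; has-finite = λ { F (xs , F≐) →
      enumerated xs
      , I.has-finite (enumerated xs) (map proj₁ xs , λ x → mk⇔ Any.map⁺ Any.map⁻)
      , F≐ }
  ; proper     = λ { (B , B∈I , full≐) →
      A⁺ (I.⊆-closed A B (λ x a → to (full≐ (x , a)) tt) B∈I) }
  }
  where
  module I = Ideal I
  module X = Setoid X
  open Equivalence using (to; from)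

  image : Subset ∣ A ∣ₛ → Subset X
  image C = record
    { pred = λ x → Σ (x ∈ A) λ a → pred C (x , a)
    ; resp = λ { e (a , c) → resp A e a , resp C e c }
    }

  enumerated : List (Setoid.Carrier ∣ A ∣ₛ) → Subset X
  enumerated xs = record
    { pred = λ x → Any (λ y → x X.≈ proj₁ y) xs
    ; resp = λ e → Any.map (X.trans (X.sym e))
    }

infix 4 _≤K_ _≅_

_≤K_ : {X Y : Setoid 0ℓ 0ℓ} → Ideal X → Ideal Y → Set₁
_≤K_ {X} {Y} I K = Σ (Func Y X) λ f → ∀ B → B ∈ᴵ I → preimage f B ∈ᴵ K

_≅_ : {X Y : Setoid 0ℓ 0ℓ} → Ideal X → Ideal Y → Set₁
_≅_ {X} {Y} I K =
  Σ (Bijection Y X) λ f →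
    ∀ B → preimage (Injection.function (Bijection.injection f)) B ∈ᴵ K ⇔ B ∈ᴵ I

Homogeneous : {X : Setoid 0ℓ 0ℓ} → Ideal X → Set₁
Homogeneous I = ∀ A (A⁺ : A ∈⁺ I) → restrict I A A⁺ ≅ I

≤K-Homogeneous : {X : Setoid 0ℓ 0ℓ} → Ideal X → Set₁
≤K-Homogeneous I = ∀ A (A⁺ : A ∈⁺ I) → restrict I A A⁺ ≤K I × I ≤K restrict I A A⁺

ω : Setoid 0ℓ 0ℓ
ω = setoid ℕ

-- The enumeration is total on ℕ, so lacunary sets are infinite; finite sets
-- are added as separate generators below.
record Lacunary (A : Subset ω) : Set where
  field
    enum       : ℕ → ℕ
    increasing : ∀ n → enum n < enum (suc n)
    enumerates : ∀ x → x ∈ A ⇔ (∃ λ n → enum n ≡ x)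
    -- ∸ is true subtraction here, since enum is increasing.
    gaps→∞     : ∀ M → ∃ λ N → ∀ n → N ≤ n → M ≤ enum (suc n) ∸ enum n

∈𝓛 : Subset ω → Set₁
∈𝓛 B = ∃ λ As → All (λ A → Lacunary A ⊎ Finite A) As × B ⊆ ⋃ As

-- Eventually, distinct elements of A are at distance at least M.
Sparse : ℕ → Subset ω → Set
Sparse M A = ∃ λ N → ∀ x y → N ≤ x → x < y → x ∈ A → y ∈ A → M + x ≤ y

lacunary⇒sparse : ∀ M A → Lacunary A → Sparse M A
lacunary⇒sparse M A L = enum N , λ x y N≤x x<y x∈A y∈A →
    sparse (to (enumerates x) x∈A) (to (enumerates y) y∈A) N≤x x<y
  where
  open Lacunary L
  open Equivalence using (to)
  N = proj₁ (gaps→∞ M)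

  mono′ : ∀ {i j} → i ≤′ j → enum i ≤ enum j
  mono′ ≤′-refl       = ≤-refl
  mono′ (≤′-step i≤j) = ≤-trans (mono′ i≤j) (<⇒≤ (increasing _))

  mono : ∀ {i j} → i ≤ j → enum i ≤ enum j
  mono = mono′ ∘ ≤⇒≤′

  reflect< : ∀ {i j} → enum i < enum j → i < j
  reflect< lt = ≰⇒> (λ j≤i → <⇒≱ lt (mono j≤i))

  reflect≤ : ∀ {i} → enum N ≤ enum i → N ≤ i
  reflect≤ le = ≮⇒≥ (λ i<N → <⇒≱ (≤-trans (increasing _) (mono i<N)) le)

  sparse : ∀ {x y} → (∃ λ n → enum n ≡ x) → (∃ λ n → enum n ≡ y) →
           enum N ≤ x → x < y → M + x ≤ y
  sparse (i , refl) (j , refl) N≤x x<y = begin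
    M + enum i                          ≤⟨ +-monoˡ-≤ (enum i) (proj₂ (gaps→∞ M) i (reflect≤ N≤x)) ⟩
    (enum (suc i) ∸ enum i) + enum i    ≡⟨ m∸n+n≡m (<⇒≤ (increasing i)) ⟩
    enum (suc i)                        ≤⟨ mono (reflect< x<y) ⟩
    enum j                              ∎
    where open ≤-Reasoning

finite⇒sparse : ∀ M A → Finite A → Sparse M A
finite⇒sparse M A (xs , A≐) = suc (max 0 xs) , λ x y N≤x _ x∈A _ →
  contradiction (All.lookup (xs≤max 0 xs) (Equivalence.to (A≐ x) x∈A)) (<⇒≱ N≤x)

uniform : ∀ M As → All (λ A → Lacunary A ⊎ Finite A) As →
          ∃ λ N → ∀ (i : Fin (length As)) x y → N ≤ x → x < y →
                  x ∈ lookup As i → y ∈ lookup As i → M + x ≤ y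
uniform M []       []       = 0 , λ ()
uniform M (A ∷ As) (g ∷ gs) = N₁ ⊔ N₂ , λ
  { Fin.zero    x y N≤x → s₁ x y (m⊔n≤o⇒m≤o N₁ N₂ N≤x)
  ; (Fin.suc i) x y N≤x → s₂ i x y (m⊔n≤o⇒n≤o N₁ N₂ N≤x)
  }
  where
  sp : Sparse M A
  sp = [ lacunary⇒sparse M A , finite⇒sparse M A ]′ g
  N₁ = proj₁ sp
  s₁ = proj₂ sp
  N₂ = proj₁ (uniform M As gs)
  s₂ = proj₂ (uniform M As gs)

𝓛-proper : ¬ ∈𝓛 Full
𝓛-proper (As , gs , cover) =
  let k = length As
      N , sparse = uniform (suc k) As gs
      c = λ (i : Fin (suc k)) → cover (N + toℕ i) tt
      i , j , i<j , same = pigeonhole ≤-refl (proj₁ ∘ c)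
      far = sparse (proj₁ (c j)) (N + toℕ i) (N + toℕ j)
              (m≤m+n N _) (+-monoʳ-< N i<j)
              (subst (λ l → (N + toℕ i) ∈ lookup As l) same (proj₂ (c i)))
              (proj₂ (c j))
  in <⇒≱ (begin-strict
       N + toℕ j           ≤⟨ +-monoʳ-≤ N (toℕ≤pred[n] j) ⟩
       N + k               ≡⟨ +-comm N k ⟩
       k + N               ≤⟨ +-monoʳ-≤ k (m≤m+n N (toℕ i)) ⟩
       k + (N + toℕ i)     <⟨ n<1+n _ ⟩
       suc k + (N + toℕ i) ∎) far
  where open ≤-Reasoning

lookup-++ : ∀ (As Bs : List (Subset ω)) {x} → x ∈ ⋃ As ⊎ x ∈ ⋃ Bs → x ∈ ⋃ (As ++ Bs)
lookup-++ []       Bs (inj₂ q)                 = q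
lookup-++ (A ∷ As) Bs (inj₁ (Fin.zero , p))    = Fin.zero , p
lookup-++ (A ∷ As) Bs (inj₁ (Fin.suc i , p))   =
  let j , q = lookup-++ As Bs (inj₁ (i , p)) in Fin.suc j , q
lookup-++ (A ∷ As) Bs (inj₂ q)                 =
  let j , q′ = lookup-++ As Bs (inj₂ q) in Fin.suc j , q′

𝓛 : Ideal ω
𝓛 = record
  { Member     = ∈𝓛
  ; ∪-closed   = λ { A B (As , gs , A⊆) (Bs , hs , B⊆) →
      As ++ Bs , All.++⁺ gs hs
      , λ { x (inj₁ a) → lookup-++ As Bs (inj₁ (A⊆ x a))
          ; x (inj₂ b) → lookup-++ As Bs (inj₂ (B⊆ x b)) } }
  ; ⊆-closed   = λ { A B A⊆B (Bs , hs , B⊆) → Bs , hs , λ x a → B⊆ x (A⊆B x a) }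
  ; has-finite = λ A fin → [ A ] , inj₂ fin ∷ [] , λ x a → Fin.zero , a
  ; proper     = 𝓛-proper
  }

{-# OPTIONS --safe #-}
module Submission where

-- Both claims fail at one positive set, A = { 2^j (m² + i) : i ≤ j }: there is
-- no f : ω → A under which all preimages of members of 𝓛 ↾ A are in 𝓛.  An
-- isomorphism between 𝓛 ↾ A and 𝓛 would contain such a reduction.
--
-- The set A is the union of its rows, one for each j.  A row is a union of j + 1
-- quadratic sequences and so lies in 𝓛, but j is unbounded: for every k, A has
-- infinitely many clusters of k + 1 points within distance 2^k k.  A set in 𝓛
-- admits, for some k, only finitely many clusters of k + 1 points of each given
-- diameter (no-clusters), so A is positive.
--
-- Let f be a reduction.  The rows below j together with an initial segment of ω
-- form a set in 𝓛, so its preimage is in 𝓛 and misses arbitrarily long windows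
-- of consecutive numbers (missed-window).  This gives a window of length j + 1
-- on which all values of f lie in rows ≥ j, hence are multiples of 2^j, and are
-- as large as desired.  Choosing these windows for j = 0, 1, 2, … in turn, each
-- with values beyond all those before it, puts the values on the j-th window
-- among the multiples of 2^j in an interval [ 2^j q_j , 2^(j+1) q_(j+1) ).  The
-- multiples of 2^j in the j-th interval, over all j, form one lacunary set D.
-- The preimage of D contains every chosen window, so it contains clusters of
-- every size arbitrarily far out and is not in 𝓛.

open import Defs
open import Data.Empty using (⊥)
open import Data.Fin.Base as Fin using (Fin; toℕ)
open import Data.Fin.Properties using (pigeonhole; toℕ<n; toℕ≤pred[n]; any?)
open import Data.List.Base using ([]; _∷_; [_]; length; lookup; applyUpTo)
open import Data.List.Extrema.Nat using (max; xs≤max)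
open import Data.List.Relation.Unary.All as All using ([]; _∷_)
open import Data.List.Relation.Unary.All.Properties using (applyUpTo⁻)
open import Data.List.Relation.Unary.Any using (here; there)
open import Data.Nat.Base hiding (pred)
open import Data.Nat.Properties
open import Data.Nat.Tactic.RingSolver using (solve-∀)
open import Data.Product using (∃; _×_; _,_; proj₁; proj₂)
open import Data.Sum using (_⊎_; inj₁; inj₂)
open import Function.Base using (_∘_; id)
open import Function.Bundles using (Func; Injection; Bijection; Equivalence; mk⇔)
open import Relation.Binary.PropositionalEquality
  using (_≡_; refl; sym; trans; cong; subst; module ≡-Reasoning)
open import Relation.Nullary using (¬_; ¬?; Dec; yes; no; contradiction)
open import Relation.Nullary.Decidable using (_⊎-dec_; decidable-stable)
open import Relation.Unary using (Decidable)

-- Sets in 𝓛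

⟦_⟧ : (ℕ → Set) → Subset ω
⟦ P ⟧ = record { pred = P ; resp = λ { refl p → p } }

range : (ℕ → ℕ) → Subset ω
range e = ⟦ (λ x → ∃ λ n → e n ≡ x) ⟧

range∈𝓛 : ∀ (e gap : ℕ → ℕ) → (∀ n → e (suc n) ≡ gap n + e n) → (∀ n → 0 < gap n) →
          (∀ M → ∃ λ N → ∀ n → N ≤ n → M ≤ gap n) → range e ∈ᴵ 𝓛
range∈𝓛 e gap step pos gap→∞ = [ range e ] , inj₁ lac ∷ [] , λ _ r → Fin.zero , r
  where
  difference : ∀ n → e (suc n) ∸ e n ≡ gap n
  difference n = trans (cong (_∸ e n) (step n)) (m+n∸n≡m (gap n) (e n))

  lac : Lacunary (range e)
  lac = record
    { enum       = e
    ; increasing = λ n → subst (e n <_) (sym (step n)) (+-monoˡ-< (e n) (pos n))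
    ; enumerates = λ _ → mk⇔ id id
    ; gaps→∞     = λ M → let N , far = gap→∞ M in
        N , λ n N≤n → subst (M ≤_) (sym (difference n)) (far n N≤n)
    }

⋃< : (ℕ → Subset ω) → ℕ → Subset ω
⋃< P n = ⟦ (λ x → ∃ λ i → i < n × x ∈ P i) ⟧

⋃<∈𝓛 : ∀ P → (∀ i → P i ∈ᴵ 𝓛) → ∀ n → ⋃< P n ∈ᴵ 𝓛
⋃<∈𝓛 P P∈ zero    = [] , [] , λ { x (i , () , p) }
⋃<∈𝓛 P P∈ (suc n) = Ideal.⊆-closed 𝓛 (⋃< P (suc n)) (⋃< P n ∪ P n) split
  (Ideal.∪-closed 𝓛 (⋃< P n) (P n) (⋃<∈𝓛 P P∈ n) (P∈ n))
  where
  split : ⋃< P (suc n) ⊆ (⋃< P n ∪ P n)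
  split x (i , i<1+n , p) with m≤n⇒m<n∨m≡n (s≤s⁻¹ i<1+n)
  ... | inj₁ i<n  = inj₁ (i , i<n , p)
  ... | inj₂ refl = inj₂ p

below : ℕ → Subset ω
below = ⋃< (λ i → ⟦ _≡ i ⟧)

below∈𝓛 : ∀ n → below n ∈ᴵ 𝓛
below∈𝓛 = ⋃<∈𝓛 (λ i → ⟦ _≡ i ⟧) λ i →
  Ideal.has-finite 𝓛 ⟦ _≡ i ⟧ ([ i ] , λ x → mk⇔ here (λ { (here e) → e ; (there ()) }))

-- Clusters and gaps of sets in 𝓛

Clustered : ∀ {n} → ℕ → (Fin n → ℕ) → Set
Clustered M c = ∀ i j → i Fin.< j → c i < c j × c j < M + c i

-- Take k to be the number of lacunary or finite sets in a cover.  Two of any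
-- k + 1 points lie in the same one of them, and far out the distinct points of
-- that set are at distance at least M.
no-clusters : ∀ S → S ∈ᴵ 𝓛 → ∃ λ k → ∀ M → ∃ λ N → (c : Fin (suc k) → ℕ) →
              (∀ i → N ≤ c i) → Clustered M c → ¬ (∀ i → c i ∈ S)
no-clusters S (As , gs , cover) = length As , λ M →
  let N , sparse = uniform M As gs in
  N , λ c N≤c clustered c∈S →
    let i , j , i<j , same = pigeonhole ≤-refl (λ i → proj₁ (cover (c i) (c∈S i)))
        ci<cj , cj<M+ci    = clustered i j i<j
    in <⇒≱ cj<M+ci
         (sparse _ (c i) (c j) (N≤c i) ci<cj
           (subst (λ l → c i ∈ lookup As l) same (proj₂ (cover (c i) (c∈S i))))
           (proj₂ (cover (c j) (c∈S j))))

-- Consider k + 1 consecutive windows of length L, with k the cluster bound of S.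
-- If P held somewhere in each of them, these k + 1 points of S would form a
-- cluster.  Decidability of P turns this into a search for the missed window.
missed-window : ∀ S → S ∈ᴵ 𝓛 → {P : ℕ → Set} → Decidable P → (∀ x → P x → x ∈ S) →
                ∀ L N → ∃ λ s → N ≤ s × (∀ i → i < L → ¬ P (s + i))
missed-window S S∈𝓛 {P} P? P⊆S L N = decide (any? (¬? ∘ met?))
  where
  k  = proj₁ (no-clusters S S∈𝓛)
  N₀ = proj₁ (proj₂ (no-clusters S S∈𝓛) (suc k * L))

  b = N₀ + N

  left : Fin (suc k) → ℕ
  left a = b + toℕ a * L

  Met : Fin (suc k) → Set
  Met a = ∃ λ i → i < L × P (left a + i)

  met? : Decidable Met
  met? a = anyUpTo? (λ i → P? (left a + i)) L

  all-met : ¬ (∀ a → Met a)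
  all-met m = proj₂ (proj₂ (no-clusters S S∈𝓛) (suc k * L)) c
    (λ a → ≤-trans (m≤m+n N₀ N) (≤-trans (m≤m+n b _) (m≤m+n (left a) _)))
    (λ a a′ a<a′ → increasing a<a′ , near a a′)
    (λ a → P⊆S _ (proj₂ (proj₂ (m a))))
    where
    open ≤-Reasoning

    c : Fin (suc k) → ℕ
    c a = left a + proj₁ (m a)

    c<end : ∀ a → c a < b + suc (toℕ a) * L
    c<end a = begin-strict
      left a + proj₁ (m a)    <⟨ +-monoʳ-< (left a) (proj₁ (proj₂ (m a))) ⟩
      b + toℕ a * L + L       ≡⟨ +-assoc b _ L ⟩
      b + (toℕ a * L + L)     ≡⟨ cong (b +_) (+-comm (toℕ a * L) L) ⟩
      b + suc (toℕ a) * L     ∎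

    increasing : ∀ {a a′} → a Fin.< a′ → c a < c a′
    increasing {a} {a′} a<a′ = begin-strict
      c a                     <⟨ c<end a ⟩
      b + suc (toℕ a) * L     ≤⟨ +-monoʳ-≤ b (*-monoˡ-≤ L a<a′) ⟩
      left a′                 ≤⟨ m≤m+n _ _ ⟩
      c a′                    ∎

    near : ∀ a a′ → c a′ < suc k * L + c a
    near a a′ = begin-strict
      c a′                    <⟨ c<end a′ ⟩
      b + suc (toℕ a′) * L    ≤⟨ +-monoʳ-≤ b (*-monoˡ-≤ L (toℕ<n a′)) ⟩
      b + suc k * L           ≡⟨ +-comm b _ ⟩
      suc k * L + b           ≤⟨ +-monoʳ-≤ (suc k * L) (≤-trans (m≤m+n b _) (m≤m+n (left a) _)) ⟩
      suc k * L + c a         ∎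

  decide : Dec (∃ λ a → ¬ Met a) → ∃ λ s → N ≤ s × (∀ i → i < L → ¬ P (s + i))
  decide (yes (a , ¬met)) =
    left a , ≤-trans (m≤n+m N N₀) (m≤m+n b _) , λ i i<L p → ¬met (i , i<L , p)
  decide (no ¬∃) =
    contradiction (λ a → decidable-stable (met? a) (λ ¬met → ¬∃ (a , ¬met))) all-met

-- Concatenating multiples of growing powers of two

n≤2^n : ∀ n → n ≤ 2 ^ n
n≤2^n n = <⇒≤ (n<2^n n)
  where
  n<2^n : ∀ n → n < 2 ^ n
  n<2^n zero    = s≤s z≤n
  n<2^n (suc n) = ≤-trans (+-mono-≤ (m^n>0 2 n) (n<2^n n))
                    (+-monoʳ-≤ (2 ^ n) (≤-reflexive (sym (+-identityʳ (2 ^ n)))))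

-- The set of all 2^j w with q j ≤ w < 2 q (j + 1) is lacunary: its stages, one
-- for each j, lie one after another, with gaps 2^j inside stage j.  The step from
-- stage j to stage j + 1 also has length 2^j, because the upper end 2^j · 2 q (j + 1)
-- of stage j is the first element of stage j + 1.
module Coarsening (q : ℕ → ℕ) (q-grows : ∀ j → q j < 2 * q (suc j)) where

  -- The pair (j , w) stands for the element 2^j w of stage j.
  State : Set
  State = ℕ × ℕ

  value : State → ℕ
  value (j , w) = 2 ^ j * w

  -- The decision is a separate argument so that next can be analysed by cases
  -- on it.
  advance : ∀ j w → Dec (suc w ≡ 2 * q (suc j)) → State
  advance j w (yes _) = suc j , q (suc j)
  advance j w (no _)  = j , suc w

  next : State → State
  next (j , w) = advance j w (suc w ≟ 2 * q (suc j))

  state : ℕ → State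
  state zero    = 0 , q 0
  state (suc n) = next (state n)

  value-next : ∀ s → value (next s) ≡ 2 ^ proj₁ s + value s
  value-next (j , w) with suc w ≟ 2 * q (suc j)
  ... | no _  = *-suc (2 ^ j) w
  ... | yes e = trans (regroup (2 ^ j) (q (suc j)))
                  (trans (cong (2 ^ j *_) (sym e)) (*-suc (2 ^ j) w))
    where
    regroup : ∀ p r → 2 * p * r ≡ p * (2 * r)
    regroup = solve-∀

  stage-next : ∀ s → proj₁ s ≤ proj₁ (next s)
  stage-next (j , w) with suc w ≟ 2 * q (suc j)
  ... | no _  = ≤-refl
  ... | yes _ = n≤1+n j

  stage-mono : ∀ {n n′} → n ≤′ n′ → proj₁ (state n) ≤ proj₁ (state n′)
  stage-mono ≤′-refl     = ≤-refl
  stage-mono (≤′-step l) = ≤-trans (stage-mono l) (stage-next _)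

  within : ∀ n {j w} → state n ≡ (j , w) → ∀ i → w + i < 2 * q (suc j) →
           state (i + n) ≡ (j , w + i)
  within n {j} {w} e zero    _ rewrite +-identityʳ w = e
  within n {j} {w} e (suc i) l
    rewrite within n e i (≤-trans (s≤s (+-monoʳ-≤ w (n≤1+n i))) l) | +-suc w i
    with suc (w + i) ≟ 2 * q (suc j)
  ... | yes e′ = contradiction e′ (<⇒≢ l)
  ... | no _   = refl

  cross : ∀ n {j w} → state n ≡ (j , w) → suc w ≡ 2 * q (suc j) →
          state (suc n) ≡ (suc j , q (suc j))
  cross n {j} {w} e full rewrite e with suc w ≟ 2 * q (suc j)
  ... | yes _ = refl
  ... | no ≢  = contradiction full ≢

  -- Every stage is reached because stage j has exactly 2 q (j + 1) ∸ q j elements,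
  -- a positive number; i is the number of steps to the last of them.
  arrival : ∀ j → ∃ λ n → state n ≡ (j , q j)
  arrival zero    = 0 , refl
  arrival (suc j) =
    let n , e = arrival j
        i     = 2 * q (suc j) ∸ suc (q j)
        last  = m+[n∸m]≡n (q-grows j)
    in suc (i + n) , cross (i + n) (within n e i (≤-reflexive last)) last

  D : Subset ω
  D = range (value ∘ state)

  -- The gap at the n-th element is 2 to the power of its stage; it is at least M
  -- from the first element of stage M on.
  D∈𝓛 : D ∈ᴵ 𝓛
  D∈𝓛 = range∈𝓛 (value ∘ state) (λ n → 2 ^ proj₁ (state n))
    (value-next ∘ state)
    (λ n → m^n>0 2 (proj₁ (state n)))
    (λ M → let N , e = arrival M in N , λ n N≤n →
      ≤-trans (n≤2^n M)
        (^-monoʳ-≤ 2 (subst (λ s → proj₁ s ≤ proj₁ (state n)) e (stage-mono (≤⇒≤′ N≤n)))))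

  multiple∈D : ∀ j w → q j ≤ w → w < 2 * q (suc j) → (2 ^ j * w) ∈ D
  multiple∈D j w q≤w w< =
    let n , e = arrival j
        eq    = m+[n∸m]≡n q≤w
    in (w ∸ q j) + n
       , trans (cong value (within n e (w ∸ q j) (subst (_< 2 * q (suc j)) (sym eq) w<)))
               (cong (2 ^ j *_) eq)

-- The positive set

point : ℕ → ℕ → ℕ → ℕ
point j i m = 2 ^ j * (m * m + i)

Row : ℕ → Subset ω
Row j = ⋃< (λ i → range (point j i)) (suc j)

A : Subset ω
A = ⟦ (λ x → ∃ λ j → x ∈ Row j) ⟧

-- Each of the j + 1 sequences has gaps 2^j (2m + 1).
Row∈𝓛 : ∀ j → Row j ∈ᴵ 𝓛
Row∈𝓛 j = ⋃<∈𝓛 (λ i → range (point j i)) (λ i → range∈𝓛 (point j i) (λ m → 2 ^ j * (1 + 2 * m))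
    (λ m → square (2 ^ j) i m)
    (λ m → *-mono-≤ (m^n>0 2 j) (s≤s (z≤n {2 * m})))
    (λ M → M , λ m M≤m → begin
      M                    ≤⟨ M≤m ⟩
      m                    ≤⟨ m≤m+n m _ ⟩
      2 * m                ≤⟨ n≤1+n _ ⟩
      1 + 2 * m            ≡⟨ *-identityˡ _ ⟨
      1 * (1 + 2 * m)      ≤⟨ *-monoˡ-≤ (1 + 2 * m) (m^n>0 2 j) ⟩
      2 ^ j * (1 + 2 * m)  ∎))
  (suc j)
  where
  open ≤-Reasoning

  square : ∀ p i m → p * ((1 + m) * (1 + m) + i) ≡ p * (1 + 2 * m) + p * (m * m + i)
  square = solve-∀

-- In row k, the points 2^k (N² + i) for i ≤ k form a cluster of k + 1 points of
-- diameter 2^k k, none of them below N.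
A∈⁺𝓛 : A ∈⁺ 𝓛
A∈⁺𝓛 A∈𝓛 =
  let k , bounded = no-clusters A A∈𝓛
      p           = 2 ^ k
      N , none    = bounded (suc (p * k))
      c           = λ (i : Fin (suc k)) → point k (toℕ i) N
  in none c
       (λ i → ≤-trans (N≤N² N) (≤-trans (m≤m+n _ (toℕ i)) (2^-expands k _)))
       (λ i j i<j →
         *-monoʳ-< p {{m^n≢0 2 k}} (+-monoʳ-< (N * N) i<j)
         , s≤s (begin
             p * (N * N + toℕ j)          ≤⟨ *-monoʳ-≤ p (+-mono-≤ (m≤m+n (N * N) (toℕ i)) (toℕ≤pred[n] j)) ⟩
             p * (N * N + toℕ i + k)      ≡⟨ *-distribˡ-+ p _ k ⟩
             p * (N * N + toℕ i) + p * k  ≡⟨ +-comm _ (p * k) ⟩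
             p * k + p * (N * N + toℕ i)  ∎))
       (λ i → k , toℕ i , toℕ<n i , N , refl)
  where
  open ≤-Reasoning

  N≤N² : ∀ N → N ≤ N * N
  N≤N² zero    = z≤n
  N≤N² (suc N) = m≤m*n (suc N) (suc N)

  2^-expands : ∀ k x → x ≤ 2 ^ k * x
  2^-expands k x = m≤n*m x (2 ^ k) {{m^n≢0 2 k}}

point-multiple : ∀ {j t} i m → j ≤ t → ∃ λ w → point t i m ≡ 2 ^ j * w
point-multiple {j} {t} i m j≤t = 2 ^ (t ∸ j) * (m * m + i) , (begin
  2 ^ t * (m * m + i)                    ≡⟨ cong (λ n → 2 ^ n * (m * m + i)) (m+[n∸m]≡n j≤t) ⟨
  2 ^ (j + (t ∸ j)) * (m * m + i)        ≡⟨ cong (_* (m * m + i)) (^-distribˡ-+-* 2 j (t ∸ j)) ⟩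
  2 ^ j * 2 ^ (t ∸ j) * (m * m + i)      ≡⟨ *-assoc (2 ^ j) _ _ ⟩
  2 ^ j * (2 ^ (t ∸ j) * (m * m + i))    ∎)
  where open ≡-Reasoning

-- A reduction to 𝓛 and its contradiction

module _ (f : Func ω ∣ A ∣ₛ)
         (katetov : ∀ B → B ∈ᴵ restrict 𝓛 A A∈⁺𝓛 → preimage f B ∈ᴵ 𝓛) where

  -- The row of f x is read off from the witness that f x belongs to A.  Rows may
  -- overlap, so this is a choice among the rows that contain the value.
  val row : ℕ → ℕ
  val x = proj₁ (Func.to f x)
  row x = proj₁ (proj₂ (Func.to f x))

  preimage∈𝓛 : ∀ B → B ∈ᴵ 𝓛 → preimage f (trace A B) ∈ᴵ 𝓛
  preimage∈𝓛 B B∈𝓛 = katetov (trace A B) (B , B∈𝓛 , λ _ → mk⇔ id id)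

  HighWindow : ℕ → ℕ → ℕ → Set
  HighWindow j q s = j ≤ s × (∀ i → i < suc j → ∃ λ w → q ≤ w × val (s + i) ≡ 2 ^ j * w)

  -- The union of the rows below j and of the numbers below 2^j q is in 𝓛.  A window
  -- missed by its preimage has only values in rows ≥ j that are at least 2^j q.
  high-window : ∀ j q → ∃ (HighWindow j q)
  high-window j q =
    let s , j≤s , missed = missed-window (preimage f (trace A S)) (preimage∈𝓛 S S∈𝓛) low? low⊆S (suc j) j
    in s , j≤s , λ i i≤j → high (s + i) (missed i i≤j)
    where
    S = ⋃< Row j ∪ below (2 ^ j * q)

    S∈𝓛 : S ∈ᴵ 𝓛
    S∈𝓛 = Ideal.∪-closed 𝓛 (⋃< Row j) (below (2 ^ j * q)) (⋃<∈𝓛 Row Row∈𝓛 j) (below∈𝓛 _)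

    Low : ℕ → Set
    Low x = row x < j ⊎ val x < 2 ^ j * q

    low? : Decidable Low
    low? x = (row x <? j) ⊎-dec (val x <? 2 ^ j * q)

    low⊆S : ∀ x → Low x → val x ∈ S
    low⊆S x (inj₁ r<j) = inj₁ (row x , r<j , proj₂ (proj₂ (Func.to f x)))
    low⊆S x (inj₂ v<)  = inj₂ (val x , v< , refl)

    high : ∀ x → ¬ Low x → ∃ λ w → q ≤ w × val x ≡ 2 ^ j * w
    high x ¬low with Func.to f x
    ... | _ , t , i , _ , m , refl =
      let w , eq = point-multiple i m (≮⇒≥ (¬low ∘ inj₁))
      in w , *-cancelˡ-≤ (2 ^ j) {{m^n≢0 2 j}} (≤-trans (≮⇒≥ (¬low ∘ inj₂)) (≤-reflexive eq)) , eq

  window : ℕ → ℕ → ℕ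
  window j q = proj₁ (high-window j q)

  values : ℕ → ℕ → ℕ → ℕ
  values j q i = val (window j q + i)

  -- Stage j + 1 has to start beyond all values on the j-th window.  As such a value
  -- is 2^j w ≥ w, the values themselves bound the factors w.
  q : ℕ → ℕ
  q zero    = 0
  q (suc j) = suc (q j + max 0 (applyUpTo (values j (q j)) (suc j)))

  q-grows : ∀ j → q j < 2 * q (suc j)
  q-grows j = ≤-trans (s≤s (m≤m+n (q j) _)) (m≤m+n (q (suc j)) _)

  open Coarsening q q-grows

  window⊆D : ∀ j i → i < suc j → values j (q j) i ∈ D
  window⊆D j i i≤j =
    let w , q≤w , eq = proj₂ (proj₂ (high-window j (q j))) i i≤j
        vs           = applyUpTo (values j (q j)) (suc j)
        w<2q = begin-strict
          w                     ≤⟨ m≤n*m w (2 ^ j) {{m^n≢0 2 j}} ⟩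
          2 ^ j * w             ≡⟨ eq ⟨
          values j (q j) i      ≤⟨ applyUpTo⁻ (values j (q j)) (suc j) (xs≤max 0 vs) i≤j ⟩
          max 0 vs              ≤⟨ m≤n+m _ (q j) ⟩
          q j + max 0 vs        <⟨ n<1+n _ ⟩
          q (suc j)             ≤⟨ m≤m+n _ _ ⟩
          2 * q (suc j)         ∎
    in subst (_∈ D) (sym eq) (multiple∈D j w q≤w w<2q)
    where open ≤-Reasoning

  -- With k the cluster bound of the preimage of D and N the point from which it
  -- holds for diameter k, the window number k + N contains k + 1 consecutive points
  -- and does not start before N.
  impossible : ⊥
  impossible =
    let k , bounded = no-clusters (preimage f (trace A D)) (preimage∈𝓛 D D∈𝓛)
        N , none    = bounded (suc k)
        j           = k + N
        s           = window j (q j)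
        j≤s         = proj₁ (proj₂ (high-window j (q j)))
    in none (λ i → s + toℕ i)
         (λ i → ≤-trans (m≤n+m N k) (≤-trans j≤s (m≤m+n s _)))
         (λ i i′ i<i′ → +-monoʳ-< s i<i′ , s≤s (begin
            s + toℕ i′         ≤⟨ +-mono-≤ (m≤m+n s (toℕ i)) (toℕ≤pred[n] i′) ⟩
            s + toℕ i + k      ≡⟨ +-comm _ k ⟩
            k + (s + toℕ i)    ∎))
         (λ i → window⊆D j (toℕ i) (≤-trans (toℕ<n i) (s≤s (m≤m+n k N))))
    where open ≤-Reasoning

proposition10p3 : ¬ (≤K-Homogeneous 𝓛) × ¬ (Homogeneous 𝓛)
proposition10p3 =
    (λ hom → let f , katetov = proj₁ (hom A A∈⁺𝓛) in impossible f katetov)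
  , (λ hom → let f , iso = hom A A∈⁺𝓛 in
      impossible (Injection.function (Bijection.injection f)) (λ B → Equivalence.from (iso B)))
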